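{- Let $m,R,\delta$ be positive integers. If $\log^{(2\delta-2)} m \geq 2^{2^{2+2R}}$, then $\chi(U(m,R,\delta)) \leq 2^{2^{2+2R}} \cdot \log^{(2\delta)} m$.
   Context: $\log^{(j)}$ denotes the base-2 logarithm iterated $j$ times ($\log^{(0)}m=m$). A chain of length $f$ and size $s$ in $[m]$ is a nested sequence $A_0\subseteq\cdots\subseteq A_f\subseteq[m]$ with $|A_0|=1$, $|A_f|=s$, written $\langle\alpha,A_1,\dots,A_f\rangle$ where $A_0=\{\alpha\}$. The graph $U(m,R,\delta)$ has as vertices all chains in $[m]$ of length $\delta$ and size at most $R$, and $\langle\alpha,A_1,\dots,A_\delta\rangle$, $\langle\beta,B_1,\dots,B_\delta\rangle$ are adjacent iff $\alpha\neq\beta$, $\alpha\in B_1$, $\beta\in A_1$, and $A_i\subseteq B_{i+1}$, $B_i\subseteq A_{i+1}$ for all $1\le i\le\delta-1$. -}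

module Defs where

open import Data.Nat as ℕ using (ℕ; zero; suc; _+_; _*_; _^_)
open import Data.Nat.Properties using (m^n≢0)
open import Data.Integer as ℤ using (ℤ; +_; -[1+_])
open import Data.Rational as ℚ using (ℚ; ↥_; ↧ₙ_; 0ℚ)
open import Data.Fin using (Fin; zero; suc; toℕ; fromℕ; inject₁)
open import Data.Fin.Subset using (Subset; ⁅_⁆; _⊆_; _∈_; ∣_∣)
open import Data.Product using (Σ; ∃-syntax; _×_; _,_)
open import Data.Sum using (_⊎_)
open import Relation.Nullary using (¬_)
open import Relation.Binary.PropositionalEquality using (_≡_; _≢_)

-- Real base-2 exponentials / logarithms, encoded via rationals.
--
-- PowLt x t  :  "x < 2^t"  for rationals x > 0 and t
-- (x = a/b, t = p/s, s > 0; the comparison (a/b)^s < 2^p cleared of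
-- denominators).  Only used when 0 < x.

PowLt : ℚ → ℚ → Set
PowLt x t with ↥ t
... | + n      = ℤ.∣ ↥ x ∣ ^ ↧ₙ t ℕ.< 2 ^ n * (↧ₙ x ^ ↧ₙ t)
... | -[1+ n ] = ℤ.∣ ↥ x ∣ ^ ↧ₙ t * 2 ^ suc n ℕ.< ↧ₙ x ^ ↧ₙ t

-- Below k x q  :  "x < exp₂^{(k)}(q)"  where exp₂(y) = 2^y (real),
-- iterated k times; a lower Dedekind cut of the real number exp₂^{(k)}(q).
Below : ℕ → ℚ → ℚ → Set
Below zero    x q = x ℚ.< q
Below (suc k) x q = x ℚ.≤ 0ℚ ⊎ (0ℚ ℚ.< x × ∃[ t ] (Below k t q × PowLt x t))

-- LogIterGe k m q  :  "log^{(k)} m ≥ q"  (base-2 logarithm iterated k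
-- times, all iterates defined), i.e. exp₂^{(k)}(q) ≤ m.
LogIterGe : ℕ → ℕ → ℚ → Set
LogIterGe k m q = ¬ Below k (+ m ℚ./ 1) q

record Chain (m f : ℕ) : Set where
  field
    α    : Fin m
    A    : Fin (suc f) → Subset m
    A₀   : A zero ≡ ⁅ α ⁆
    mono : (i : Fin f) → A (inject₁ i) ⊆ A (suc i)

size : ∀ {m f} → Chain m f → ℕ
size {f = f} c = ∣ Chain.A c (fromℕ f) ∣

UVertex : ℕ → ℕ → ℕ → Set
UVertex m R δ = Σ (Chain m δ) (λ c → size c ℕ.≤ R)

UAdj : ∀ {m R δ} → UVertex m R δ → UVertex m R δ → Set
UAdj {δ = δ} (a , _) (b , _) =
    Chain.α a ≢ Chain.α b
  × ((j : Fin (suc δ)) → toℕ j ≡ 1 → Chain.α a ∈ Chain.A b j)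
  × ((j : Fin (suc δ)) → toℕ j ≡ 1 → Chain.α b ∈ Chain.A a j)
  × ((i j : Fin (suc δ)) → 1 ℕ.≤ toℕ i → toℕ j ≡ suc (toℕ i) →
       Chain.A a i ⊆ Chain.A b j × Chain.A b i ⊆ Chain.A a j)

ProperColouring : ℕ → ℕ → ℕ → ℕ → Set
ProperColouring m R δ N =
  Σ (UVertex m R δ → Fin N) λ c → ∀ u v → UAdj u v → c u ≢ c v

bigC : ℕ → ℕ
bigC R = 2 ^ (2 ^ (2 + 2 * R))

ratio : ℕ → ℕ → ℚ
ratio N R = ℚ._/_ (+ N) (bigC R) {{m^n≢0 2 (2 ^ (2 + 2 * R))}}

{-# OPTIONS --safe #-}
module Submission where

-- Read the elements of [m] as bit strings. The branching positions Br X of the trie of a finite set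
-- X are monotone in X, number at most |X| − 1, and separate the elements of X; moreover the first
-- position where two elements differ lies in Br X for every X containing both. Hence two adjacent
-- chains, whose centres both lie in A₁ ∩ B₁, differ in how a centre is read at some position common
-- to Br A₁ and Br B₁.
--
-- For δ = 1, a family of O_R(log n) functions on [n], n = log m, that extends every labelling of at
-- most R points therefore gives a proper colouring. For larger δ, reading Br A₁ at the positions
-- E = Br (Br A₁) turns the labelling of Br A₁ into a finite table, and the pair (table, E) plays the
-- part of the centre for the shorter chain Br (Br A₁) ⊆ Br (Br A₂) ⊆ …, which lives in
-- [log log m]. Each such step lowers the bound on the sizes by 2, so the factors contributed by the
-- tables stay below 2 ^ 2 ^ (2 + 2R) altogether, independently of δ.

open import Data.Bool using (Bool; true; false; T; T?; not; _∧_; if_then_else_)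
open import Data.Fin
  using (Fin; zero; suc; toℕ; fromℕ; fromℕ<; inject₁; inject≤; finToFun; funToFin; combine; _≟_)
open import Data.Fin.Properties
  using (funToFin-finToFin; finToFun-funToFin; combine-injective; fromℕ<-injective; toℕ-fromℕ<;
         toℕ-fromℕ; inject≤-injective)
open import Data.Fin.Subset
  using (Subset; inside; outside; ⁅_⁆; ∣_∣) renaming (_∈_ to _∈ₛ_; _⊆_ to _⊆ₛ_)
open import Data.Fin.Subset.Properties using (p⊆q⇒∣p∣≤∣q∣; x∈⁅x⁆; x∈⁅y⁆⇒x≡y)
open import Data.Integer as ℤ using (+_; -[1+_])
open import Data.Integer.Properties as ℤ using ()
open import Data.List
  using (List; []; _∷_; _++_; map; length; allFin; cartesianProductWith; filterᵇ)
open import Data.List.Membership.Propositional using (_∈_)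
open import Data.List.Membership.Propositional.Properties
  using (∈-map⁺; ∈-map⁻; ∈-++⁺ˡ; ∈-++⁺ʳ; ∈-++⁻; ∈-allFin; ∈-filter⁺; ∈-cartesianProductWith⁺;
         ∈-cartesianProductWith⁻)
open import Data.List.Properties
  using (length-map; length-++; length-tabulate; ∷-injectiveˡ; ∷-injectiveʳ)
open import Data.List.Relation.Binary.Subset.Propositional using (_⊆_)
open import Data.List.Relation.Binary.Subset.Propositional.Properties using (map⁺; ++⁺)
open import Data.List.Relation.Unary.Any using (here; there)
open import Data.List.Relation.Unary.All as All using (All; []; _∷_)
open import Data.List.Relation.Unary.All.Properties as All using ()
open import Data.Maybe using (Maybe; just; nothing)
open import Data.Nat
  using (ℕ; zero; suc; _+_; _*_; _∸_; _^_; _⊓_; _≤_; _<_; _≤?_; _≤′_; z≤n; s≤s; ≤′-refl; ≤′-step;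
         NonZero; ≢-nonZero⁻¹)
open import Data.Nat.Coprimality as Coprime using ()
open import Data.Nat.Divisibility using (_∣_; ∣1⇒≡1; ∣m+n∣m⇒∣n; ∣n⇒∣m*n)
open import Data.Nat.Properties hiding (_≟_)
open import Data.Product using (Σ; ∃-syntax; _×_; _,_; proj₁; proj₂)
open import Data.Rational as ℚ using (ℚ; mkℚ; _/_; *<*; *≤*)
open import Data.Rational.Properties as ℚ using ()
open import Data.Rational.Unnormalised using (mkℚᵘ; *≡*)
open import Data.Sum using (inj₁; inj₂)
open import Data.Vec using (Vec; []; _∷_; here; there; lookup; replicate; _[_]≔_)
open import Data.Vec.Properties using (lookup∘update; lookup∘update′)
open import Function using (_∘_)
open import Relation.Nullary using (¬_; does; yes; no; contradiction)
open import Relation.Binary.PropositionalEquality as ≡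
open import Algebra.Properties.CommutativeMonoid.Sum +-0-commutativeMonoid
  using (sum; ∑-distrib-+; sum-replicate-zero; sum-cong-≗)
open import Algebra.Properties.CommutativeSemigroup *-commutativeSemigroup
  using (interchange; x∙yz≈y∙xz; x∙yz≈xz∙y; x∙yz≈yx∙z; xy∙z≈y∙xz; xy∙z≈y∙zx)
open import Data.Nat.Solver using (module +-*-Solver)
open import Defs
open +-*-Solver using (solve; _:=_; _:+_; _:*_; con)

-- Branching positions of a set of bit strings

tails : ∀ {n} → Fin 2 → List (Fin (suc n) → Fin 2) → List (Fin n → Fin 2)
tails b []      = []
tails b (f ∷ X) with f zero ≟ b
... | yes _ = f ∘ suc ∷ tails b X
... | no  _ = tails b X

rootBranch : ∀ {n} {A : Set} → List A → List A → List (Fin (suc n))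
rootBranch []      _       = []
rootBranch (_ ∷ _) []      = []
rootBranch (_ ∷ _) (_ ∷ _) = zero ∷ []

-- The positions d such that two members of X agree before d and differ at d.
branch : ∀ n → List (Fin n → Fin 2) → List (Fin n)
branch zero    X = []
branch (suc n) X = rootBranch X₀ X₁ ++ map suc (branch n X₀ ++ branch n X₁)
  where
  X₀ = tails zero X
  X₁ = tails (suc zero) X

length-tails : ∀ {n} (X : List (Fin (suc n) → Fin 2)) →
  length (tails zero X) + length (tails (suc zero) X) ≡ length X
length-tails []      = refl
length-tails (f ∷ X) with f zero ≟ zero | f zero ≟ suc zero
... | yes _ | no  _ = cong suc (length-tails X)
... | no  _ | yes _ = trans (+-suc _ _) (cong suc (length-tails X))
... | yes p | yes q with () ← trans (sym p) q
... | no  p | no  q with f zero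
... | zero     = contradiction refl p
... | suc zero = contradiction refl q

-- An empty side contributes no leaf and no branching node. If both sides are nonempty, each has one
-- leaf more than it needs: one of them pays for the root, the other remains.
length-rootBranch : ∀ {n} {A B C : Set} (X Y : List A) (U : List B) (V : List C) →
  length U ≤ length X ∸ 1 → length V ≤ length Y ∸ 1 →
  length (rootBranch {n} X Y) + (length U + length V) ≤ length X + length Y ∸ 1
length-rootBranch [] Y [] V p q = q
length-rootBranch (_ ∷ X) [] U [] p q = +-monoˡ-≤ 0 p
length-rootBranch (_ ∷ X) (_ ∷ Y) U V p q =
  ≤-trans (s≤s (+-mono-≤ p q)) (≤-reflexive (sym (+-suc _ _)))

-- A binary tree with at most |X| leaves has at most |X| - 1 branching nodes. Nodes at the same
-- depth are counted separately, so repetitions in the list are harmless.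
length-branch : ∀ n (X : List (Fin n → Fin 2)) → length (branch n X) ≤ length X ∸ 1
length-branch zero    X = z≤n
length-branch (suc n) X = begin
  length (rootBranch X₀ X₁ ++ map suc (branch n X₀ ++ branch n X₁))
    ≡⟨ length-++ (rootBranch X₀ X₁) ⟩
  length (rootBranch {n} X₀ X₁) + length (map suc (branch n X₀ ++ branch n X₁))
    ≡⟨ cong (λ l → length (rootBranch {n} X₀ X₁) + l)
         (trans (length-map suc (branch n X₀ ++ branch n X₁)) (length-++ (branch n X₀))) ⟩
  length (rootBranch {n} X₀ X₁) + (length (branch n X₀) + length (branch n X₁))
    ≤⟨ length-rootBranch X₀ X₁ (branch n X₀) (branch n X₁) (length-branch n X₀) (length-branch n X₁) ⟩
  length X₀ + length X₁ ∸ 1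
    ≡⟨ cong (_∸ 1) (length-tails X) ⟩
  length X ∸ 1 ∎
  where
  open ≤-Reasoning
  X₀ = tails zero X
  X₁ = tails (suc zero) X

∈-tails⁺ : ∀ {n b f} {X : List (Fin (suc n) → Fin 2)} → f ∈ X → f zero ≡ b → f ∘ suc ∈ tails b X
∈-tails⁺ {b = b} {f} (here refl) eq with f zero ≟ b
... | yes _  = here refl
... | no  ne = contradiction eq ne
∈-tails⁺ {b = b} {X = g ∷ X} (there f∈X) eq with g zero ≟ b
... | yes _ = there (∈-tails⁺ f∈X eq)
... | no  _ = ∈-tails⁺ f∈X eq

∈-tails⁻ : ∀ {n b g} (X : List (Fin (suc n) → Fin 2)) → g ∈ tails b X →
  ∃[ f ] (f ∈ X × f zero ≡ b × f ∘ suc ≡ g)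
∈-tails⁻ {b = b} (f ∷ X) g∈ with f zero ≟ b
∈-tails⁻ (f ∷ X) (here eq)  | yes p = f , here refl , p , sym eq
∈-tails⁻ (f ∷ X) (there g∈) | yes _ with h , h∈X , p , q ← ∈-tails⁻ X g∈ = h , there h∈X , p , q
∈-tails⁻ (f ∷ X) g∈         | no  _ with h , h∈X , p , q ← ∈-tails⁻ X g∈ = h , there h∈X , p , q

tails-mono : ∀ {n b} {X Y : List (Fin (suc n) → Fin 2)} → X ⊆ Y → tails b X ⊆ tails b Y
tails-mono {X = X} X⊆Y g∈ with _ , f∈X , p , refl ← ∈-tails⁻ X g∈ = ∈-tails⁺ (X⊆Y f∈X) p

rootBranch-∈ : ∀ {n} {A : Set} {X Y : List A} {f g} → f ∈ X → g ∈ Y → zero ∈ rootBranch {n} X Y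
rootBranch-∈ {X = _ ∷ _} {_ ∷ _} _ _ = here refl

rootBranch-mono : ∀ {n} {A : Set} {X X′ Y Y′ : List A} → X ⊆ X′ → Y ⊆ Y′ →
  rootBranch {n} X Y ⊆ rootBranch X′ Y′
rootBranch-mono {X = _ ∷ _} {Y = _ ∷ _} X⊆ Y⊆ (here refl) =
  rootBranch-∈ (X⊆ (here refl)) (Y⊆ (here refl))

branch-mono : ∀ n {X Y : List (Fin n → Fin 2)} → X ⊆ Y → branch n X ⊆ branch n Y
branch-mono (suc n) X⊆Y =
  ++⁺ (rootBranch-mono (tails-mono X⊆Y) (tails-mono X⊆Y))
      (map⁺ suc (++⁺ (branch-mono n (tails-mono X⊆Y)) (branch-mono n (tails-mono X⊆Y))))

branch-suc : ∀ {n b d} (X : List (Fin (suc n) → Fin 2)) →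
  d ∈ branch n (tails b X) → suc d ∈ branch (suc n) X
branch-suc {b = zero}     X d∈ = ∈-++⁺ʳ (rootBranch _ _) (∈-map⁺ suc (∈-++⁺ˡ d∈))
branch-suc {b = suc zero} X d∈ = ∈-++⁺ʳ (rootBranch _ _) (∈-map⁺ suc (∈-++⁺ʳ (branch _ _) d∈))

branch-zero : ∀ {n f g} {X : List (Fin (suc n) → Fin 2)} →
  f ∈ X → g ∈ X → f zero ≢ g zero → zero ∈ branch (suc n) X
branch-zero {f = f} {g} f∈ g∈ ne with f zero in p | g zero in q
... | zero     | zero     = contradiction refl ne
... | zero     | suc zero = ∈-++⁺ˡ (rootBranch-∈ (∈-tails⁺ f∈ p) (∈-tails⁺ g∈ q))
... | suc zero | zero     = ∈-++⁺ˡ (rootBranch-∈ (∈-tails⁺ g∈ q) (∈-tails⁺ f∈ p))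
... | suc zero | suc zero = contradiction refl ne

-- The position does not depend on X: this is what makes adjacent vertices comparable.
branch-separates : ∀ {n} (f g : Fin n → Fin 2) → ¬ (∀ d → f d ≡ g d) →
  ∃[ d ] (f d ≢ g d × (∀ {X} → f ∈ X → g ∈ X → d ∈ branch n X))
branch-separates {zero}  f g f≢g = contradiction (λ ()) f≢g
branch-separates {suc n} f g f≢g with f zero ≟ g zero
... | no  ne = zero , ne , λ f∈ g∈ → branch-zero f∈ g∈ ne
... | yes eq
  with d , ne , common ← branch-separates (f ∘ suc) (g ∘ suc)
         (λ h → f≢g λ { zero → eq ; (suc i) → h i })
  = suc d , ne , λ {X} f∈ g∈ → branch-suc X (common (∈-tails⁺ f∈ eq) (∈-tails⁺ g∈ refl))

bit : ∀ n → Fin (2 ^ n) → Fin n → Fin 2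
bit n = finToFun

Br : ∀ n → List (Fin (2 ^ n)) → List (Fin n)
Br n X = branch n (map (bit n) X)

length-Br : ∀ n (X : List (Fin (2 ^ n))) → length (Br n X) ≤ length X ∸ 1
length-Br n X =
  ≤-trans (length-branch n (map (bit n) X)) (≤-reflexive (cong (_∸ 1) (length-map (bit n) X)))

Br-mono : ∀ n {X Y : List (Fin (2 ^ n))} → X ⊆ Y → Br n X ⊆ Br n Y
Br-mono n X⊆Y = branch-mono n (map⁺ (bit n) X⊆Y)

funToFin-cong : ∀ {m n} {f g : Fin m → Fin n} → (∀ i → f i ≡ g i) → funToFin f ≡ funToFin g
funToFin-cong {zero}  h = refl
funToFin-cong {suc m} h = cong₂ combine (h zero) (funToFin-cong (h ∘ suc))

bit-injective : ∀ n {a b : Fin (2 ^ n)} → (∀ d → bit n a d ≡ bit n b d) → a ≡ b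
bit-injective n {a} {b} h =
  trans (sym (funToFin-finToFin {n} a)) (trans (funToFin-cong h) (funToFin-finToFin {n} b))

Br-separates : ∀ n {a b : Fin (2 ^ n)} → a ≢ b →
  ∃[ d ] (bit n a d ≢ bit n b d × (∀ {X} → a ∈ X → b ∈ X → d ∈ Br n X))
Br-separates n {a} {b} a≢b
  with d , ne , common ← branch-separates (bit n a) (bit n b) (a≢b ∘ bit-injective n)
  = d , ne , λ a∈ b∈ → common (∈-map⁺ (bit n) a∈) (∈-map⁺ (bit n) b∈)

-- Bounded bit lists as numbers

pad : ∀ {r} → List (Fin 2) → Fin r → Fin 2
pad []      _       = zero
pad (b ∷ l) zero    = b
pad (b ∷ l) (suc j) = pad l j

pad-injective : ∀ {r} (l l′ : List (Fin 2)) → length l ≡ length l′ → length l ≤ r →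
  (∀ (j : Fin r) → pad l j ≡ pad l′ j) → l ≡ l′
pad-injective []      []        _  _       _ = refl
pad-injective (b ∷ l) (b′ ∷ l′) eq (s≤s p) h =
  cong₂ _∷_ (h zero) (pad-injective l l′ (suc-injective eq) p (h ∘ suc))

-- Short lists are padded with zeros, so a code determines its list only among lists of a common
-- length. This is why colours and labels below also record `size₀`.
code : ∀ r → List (Fin 2) → Fin (2 ^ r)
code r l = funToFin {r} (pad l)

code-injective : ∀ r (l l′ : List (Fin 2)) → length l ≡ length l′ → length l ≤ r →
  code r l ≡ code r l′ → l ≡ l′
code-injective r l l′ len p eq = pad-injective l l′ len p λ j →
  trans (sym (finToFun-funToFin {r} (pad l) j))
        (trans (cong (λ c → finToFun {n = r} c j) eq) (finToFun-funToFin {r} (pad l′) j))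

column : ∀ n → List (Fin (2 ^ n)) → Fin n → List (Fin 2)
column n X d = map (λ a → bit n a d) X

row : ∀ n → List (Fin n) → Fin (2 ^ n) → List (Fin 2)
row n E a = map (bit n a) E

map-≡-∈ : ∀ {A B : Set} {f g : A → B} {l a} → map f l ≡ map g l → a ∈ l → f a ≡ g a
map-≡-∈ eq (here refl) = ∷-injectiveˡ eq
map-≡-∈ eq (there a∈)  = map-≡-∈ (∷-injectiveʳ eq) a∈

-- Two distinct members of D differ at a position of `Br n D`, so the bits at these few positions
-- already name a member within D.
row-injective : ∀ n {D : List (Fin (2 ^ n))} {a b} → a ∈ D → b ∈ D →
  row n (Br n D) a ≡ row n (Br n D) b → a ≡ b
row-injective n {a = a} {b} a∈ b∈ eq with a ≟ b
... | yes a≡b = a≡b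
... | no  a≢b with d , ne , common ← Br-separates n a≢b =
  contradiction (map-≡-∈ eq (common a∈ b∈)) ne

-- Entries `a` and `a′` in the same place both belong to Y and to Y′. If they differ, their first
-- difference d lies in `Br n Y` and in `Br n Y′` at once, and the columns at d disagree there.
columns-determine : ∀ n {Y Y′ : List (Fin (2 ^ n))} (X X′ : List (Fin (2 ^ n))) →
  length X ≡ length X′ → X ⊆ Y → X ⊆ Y′ → X′ ⊆ Y → X′ ⊆ Y′ →
  (∀ d → d ∈ Br n Y → d ∈ Br n Y′ → column n X d ≡ column n X′ d) → X ≡ X′
columns-determine n []      []        _   _  _  _  _  _ = refl
columns-determine n (a ∷ X) (a′ ∷ X′) len p₁ p₂ p₃ p₄ h with a ≟ a′
... | yes refl = cong (a ∷_) (columns-determine n X X′ (suc-injective len)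
        (p₁ ∘ there) (p₂ ∘ there) (p₃ ∘ there) (p₄ ∘ there)
        (λ d d∈ d∈′ → ∷-injectiveʳ (h d d∈ d∈′)))
... | no a≢a′ with d , ne , common ← Br-separates n a≢a′ =
  contradiction
    (∷-injectiveˡ (h d (common (p₁ (here refl)) (p₃ (here refl)))
                       (common (p₂ (here refl)) (p₄ (here refl)))))
    ne

-- The value b fills the entries that are keys of no member of D; it is arbitrary.
tabulateOn : ∀ {A B : Set} {k} → (A → Fin k) → (A → B) → B → List A → Fin k → B
tabulateOn key val b []      y = b
tabulateOn key val b (a ∷ D) y with key a ≟ y
... | yes _ = val a
... | no  _ = tabulateOn key val b D y

tabulateOn-∈ : ∀ {A B : Set} {k} (key : A → Fin k) (val : A → B) b {D a} → a ∈ D →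
  (∀ {a′} → a′ ∈ D → key a′ ≡ key a → a′ ≡ a) → tabulateOn key val b D (key a) ≡ val a
tabulateOn-∈ key val b {a′ ∷ D} {a} a∈ inj with key a′ ≟ key a
... | yes eq = cong val (inj (here refl) eq)
tabulateOn-∈ key val b (here refl) inj | no ne = contradiction refl ne
tabulateOn-∈ key val b (there a∈)  inj | no ne = tabulateOn-∈ key val b a∈ (inj ∘ there)

-- Sequences X 0 ⊆ X 1 ⊆ … of sets of size at most r, with a label. U(m, R, δ) is the case of a
-- single label where X 0 lists A₀; the labels absorb the finite data left over by taking logarithms.
record State (Q r m : ℕ) : Set where
  field
    label  : Fin Q
    X      : ℕ → List (Fin m)
    bound  : ∀ i → length (X i) ≤ r
    grow   : ∀ i → X i ⊆ X (suc i)

open State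

-- Distinctness concerns the pair of label and `X 0`, since after a step the label may be all that
-- differs. The inclusions start at index 0, where they generalise α ∈ B₁ and β ∈ A₁.
record Adj {Q r m} (δ : ℕ) (u v : State Q r m) : Set where
  field
    distinct : ¬ (label u ≡ label v × X u 0 ≡ X v 0)
    fwd      : ∀ i → i < δ → X u i ⊆ X v (suc i)
    bwd      : ∀ i → i < δ → X v i ⊆ X u (suc i)

open Adj

Colouring : (Q r m δ N : ℕ) → Set
Colouring Q r m δ N = Σ (State Q r m → Fin N) λ c → ∀ u v → Adj δ u v → c u ≢ c v

size₀ : ∀ {Q r m} → State Q r m → Fin (suc r)
size₀ u = fromℕ< (s≤s (bound u 0))

size₀-injective : ∀ {Q r m} (u v : State Q r m) → size₀ u ≡ size₀ v →
  length (X u 0) ≡ length (X v 0)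
size₀-injective u v = fromℕ<-injective _ _ _ _

branch₁ : ∀ {Q r} n → State Q r (2 ^ n) → List (Fin n)
branch₁ n u = Br n (X u 1)

columnCode : ∀ {Q r} n → State Q r (2 ^ n) → Fin n → Fin (2 ^ r)
columnCode {r = r} n u d = code r (column n (X u 0) d)

columnCodes-determine : ∀ {Q r δ} n {u v : State Q r (2 ^ n)} → Adj (suc δ) u v →
  size₀ u ≡ size₀ v →
  (∀ d → d ∈ branch₁ n u → d ∈ branch₁ n v → columnCode n u d ≡ columnCode n v d) →
  X u 0 ≡ X v 0
columnCodes-determine {r = r} n {u} {v} adj sz h =
  columns-determine n (X u 0) (X v 0) len
    -- Growth and adjacency together place both centres inside both sets of index 1.
    (grow u 0) (fwd adj 0 (s≤s z≤n)) (bwd adj 0 (s≤s z≤n)) (grow v 0)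
    λ d d∈ d∈′ → code-injective r _ _ (len-column d) (bound-column d) (h d d∈ d∈′)
  where
  len : length (X u 0) ≡ length (X v 0)
  len = size₀-injective u v sz

  len-column : ∀ d → length (column n (X u 0) d) ≡ length (column n (X v 0) d)
  len-column d = trans (length-map _ (X u 0)) (trans len (sym (length-map _ (X v 0))))

  bound-column : ∀ d → length (column n (X u 0) d) ≤ r
  bound-column d = ≤-trans (≤-reflexive (length-map _ (X u 0))) (bound u 0)

-- Taking two logarithms

module _ {Q r : ℕ} (n : ℕ) where

  private
    r′ : ℕ
    -- Each of the two applications of `Br` lowers the size bound by one.
    r′ = r ∸ 1 ∸ 1

  branch₂ : State Q r (2 ^ (2 ^ n)) → List (Fin n)
  branch₂ u = Br n (branch₁ (2 ^ n) u)

  -- A member of `branch₁` is named by its bits at `branch₂`. This takes r′ bits, so the number of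
  -- possible tables does not depend on n.
  key : State Q r (2 ^ (2 ^ n)) → Fin (2 ^ n) → Fin (2 ^ r′)
  key u d = code r′ (row n (branch₂ u) d)

  table : State Q r (2 ^ (2 ^ n)) → Fin (2 ^ r′) → Fin (2 ^ r)
  table u = tabulateOn (key u) (columnCode (2 ^ n) u) (code r []) (branch₁ (2 ^ n) u)

  length-Br-Br : (Y : List (Fin (2 ^ (2 ^ n)))) → length Y ≤ r → length (Br n (Br (2 ^ n) Y)) ≤ r′
  length-Br-Br Y p = ≤-trans (length-Br n (Br (2 ^ n) Y))
    (∸-monoˡ-≤ 1 (≤-trans (length-Br (2 ^ n) Y) (∸-monoˡ-≤ 1 p)))

  table-key : ∀ u {d} → d ∈ branch₁ (2 ^ n) u → table u (key u d) ≡ columnCode (2 ^ n) u d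
  table-key u {d} d∈ = tabulateOn-∈ (key u) (columnCode (2 ^ n) u) (code r []) d∈
    λ {d′} d′∈ eq → row-injective n d′∈ d∈
      (code-injective r′ _ _
        (trans (length-map _ (branch₂ u)) (sym (length-map _ (branch₂ u))))
        (≤-trans (≤-reflexive (length-map _ (branch₂ u))) (length-Br-Br (X u 1) (bound u 1)))
        eq)

  -- The new `X 0` is `branch₂ u`, built from `X u 1`, so one level of the chain is used up. The old
  -- centre survives only through its size and its table, both moved into the label.
  step : State Q r (2 ^ (2 ^ n)) → State (Q * (suc r * (2 ^ r) ^ (2 ^ r′))) r′ n
  step u = record
    { label = combine (label u) (combine (size₀ u) (funToFin (table u)))
    ; X     = λ i → Br n (Br (2 ^ n) (X u (suc i)))
    ; bound = λ i → length-Br-Br (X u (suc i)) (bound u (suc i))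
    ; grow  = λ i → Br-mono n (Br-mono (2 ^ n) (grow u (suc i)))
    }

  -- The inclusions persist because `Br` is monotone. If labels and `branch₂` agreed, a position d
  -- common to both `branch₁` would have the same key on both sides, hence the same entry in the
  -- common table; the columns at d would agree, and with them the centres.
  step-adj : ∀ {δ u v} → Adj (suc δ) u v → Adj δ (step u) (step v)
  step-adj {δ} {u} {v} adj = record
    { distinct = λ (p , q) → same p q
    ; fwd      = λ i i<δ → Br-mono n (Br-mono (2 ^ n) (fwd adj (suc i) (s≤s i<δ)))
    ; bwd      = λ i i<δ → Br-mono n (Br-mono (2 ^ n) (bwd adj (suc i) (s≤s i<δ)))
    }
    where
    same : label (step u) ≡ label (step v) → branch₂ u ≢ branch₂ v
    same eq E≡
      with label≡ , eq′ ← combine-injective (label u) _ (label v) _ eq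
      with size≡ , table≡ ← combine-injective (size₀ u) _ (size₀ v) _ eq′
      = distinct adj (label≡ , columnCodes-determine (2 ^ n) adj size≡ λ d d∈ d∈′ → begin
          columnCode (2 ^ n) u d      ≡⟨ table-key u d∈ ⟨
          table u (key u d)           ≡⟨ finToFun-funToFin (table u) (key u d) ⟨
          finToFun (funToFin (table u)) (key u d)
            ≡⟨ cong₂ (finToFun {n = 2 ^ r′}) table≡ (cong (λ E → code r′ (row n E d)) E≡) ⟩
          finToFun (funToFin (table v)) (key v d)
            ≡⟨ finToFun-funToFin (table v) (key v d) ⟩
          table v (key v d)           ≡⟨ table-key v d∈′ ⟩
          columnCode (2 ^ n) v d      ∎)
      where open ≡-Reasoning

  step-colouring : ∀ {δ N} → Colouring (Q * (suc r * (2 ^ r) ^ (2 ^ r′))) r′ n δ N →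
    Colouring Q r (2 ^ (2 ^ n)) (suc δ) N
  step-colouring (c , proper) = c ∘ step , λ u v adj → proper _ _ (step-adj adj)

-- The case δ = 1: one logarithm and a universal family

Universal : (k q M T : ℕ) → Set
Universal k q M T = Σ (Fin T → Fin M → Fin q) λ h →
  ∀ (D : List (Fin M)) → length D ≤ k → (ℓ : Fin M → Fin q) → ∃[ i ] (∀ {d} → d ∈ D → h i d ≡ ℓ d)

-- The index of one function extending `columnCode` on `branch₁` stands for the whole labelling. If
-- two states share the index, the same function agrees with both labellings, so these agree at the
-- common positions.
base-colouring : ∀ {Q r n T} → Universal r (2 ^ r) n T → Colouring Q r (2 ^ n) 1 (Q * (suc r * T))
base-colouring {Q} {r} {n} {T} (h , universal) = c , proper
  where
  extension : (u : State Q r (2 ^ n)) →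
    ∃[ i ] (∀ {d} → d ∈ branch₁ n u → h i d ≡ columnCode n u d)
  extension u = universal (branch₁ n u)
    (≤-trans (length-Br n (X u 1)) (≤-trans (m∸n≤m _ 1) (bound u 1))) (columnCode n u)

  c : State Q r (2 ^ n) → Fin (Q * (suc r * T))
  c u = combine (label u) (combine (size₀ u) (proj₁ (extension u)))

  proper : ∀ u v → Adj 1 u v → c u ≢ c v
  proper u v adj eq
    with label≡ , eq′ ← combine-injective (label u) _ (label v) _ eq
    with size≡ , i≡ ← combine-injective (size₀ u) _ (size₀ v) _ eq′
    = distinct adj (label≡ , columnCodes-determine n adj size≡ λ d d∈ d∈′ →
        trans (sym (proj₂ (extension u) d∈))
              (trans (cong (λ i → h i d) i≡) (proj₂ (extension v) d∈′)))

-- Universal families of functions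

length-cartesianProductWith : ∀ {A B C : Set} (f : A → B → C) xs ys →
  length (cartesianProductWith f xs ys) ≡ length xs * length ys
length-cartesianProductWith f []       ys = refl
length-cartesianProductWith f (x ∷ xs) ys = trans (length-++ (map (f x) ys))
  (cong₂ _+_ (length-map (f x) ys) (length-cartesianProductWith f xs ys))

^-distribʳ-* : ∀ n m o → (m * o) ^ n ≡ m ^ n * o ^ n
^-distribʳ-* zero    m o = refl
^-distribʳ-* (suc n) m o =
  trans (cong (m * o *_) (^-distribʳ-* n m o)) (interchange m o (m ^ n) (o ^ n))

sum-const : ∀ q w → sum {q} (λ _ → w) ≡ q * w
sum-const zero    w = refl
sum-const (suc q) w = cong (λ l → w + l) (sum-const q w)

sum-indicator : ∀ {q} (y : Fin q) w → sum (λ x → if does (y ≟ x) then w else 0) ≡ w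
sum-indicator {suc q} zero    w = trans (cong (λ l → w + l) (sum-replicate-zero q)) (+-identityʳ w)
sum-indicator {suc q} (suc y) w = sum-indicator y w

sum-≤-max : ∀ {q} .{{_ : NonZero q}} (f : Fin q → ℕ) → ∃[ x ] sum f ≤ q * f x
sum-≤-max {suc zero}    f = zero , ≤-refl
sum-≤-max {suc (suc q)} f with x , p ← sum-≤-max (f ∘ suc) | ≤-total (f zero) (f (suc x))
... | inj₁ le = suc x , +-mono-≤ le p
... | inj₂ ge = zero , +-monoʳ-≤ (f zero) (≤-trans p (*-monoʳ-≤ (suc q) ge))

module _ {q : ℕ} where

  Partial : ℕ → Set
  Partial M = Vec (Maybe (Fin q)) M

  sat : ∀ {M} → Vec (Fin q) M → Partial M → Bool
  sat []      []             = true
  sat (x ∷ h) (nothing ∷ c)  = sat h c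
  sat (x ∷ h) (just y ∷ c)   = does (y ≟ x) ∧ sat h c

  sat-lookup : ∀ {M y} (h : Vec (Fin q) M) (c : Partial M) d → sat h c ≡ true →
    lookup c d ≡ just y → lookup h d ≡ y
  sat-lookup (x ∷ h) (nothing ∷ c) (suc d) s eq = sat-lookup h c d s eq
  sat-lookup (x ∷ h) (just y ∷ c)  d       s eq with y ≟ x
  sat-lookup (x ∷ h) (just y ∷ c) zero    s refl | yes p = sym p
  sat-lookup (x ∷ h) (just y ∷ c) (suc d) s eq   | yes p = sat-lookup h c d s eq

  -- The number of total functions extending a partial one.
  weight : ∀ {M} → Partial M → ℕ
  weight []            = 1
  weight (nothing ∷ c) = q * weight c
  weight (just _ ∷ c)  = weight c

  domainSize : ∀ {M} → Partial M → ℕ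
  domainSize []            = 0
  domainSize (nothing ∷ c) = domainSize c
  domainSize (just _ ∷ c)  = suc (domainSize c)

  weight-domainSize : ∀ {M} (c : Partial M) → q ^ domainSize c * weight c ≡ q ^ M
  weight-domainSize []            = refl
  weight-domainSize (nothing ∷ c) =
    trans (x∙yz≈y∙xz (q ^ domainSize c) q (weight c)) (cong (q *_) (weight-domainSize c))
  weight-domainSize (just _ ∷ c)  =
    trans (*-assoc q _ _) (cong (q *_) (weight-domainSize c))

  totalWeight : ∀ {M} → List (Partial M) → ℕ
  totalWeight []      = 0
  totalWeight (c ∷ L) = weight c + totalWeight L

  -- The partial functions still extendable once the first value is fixed as x, with that coordinate
  -- dropped.
  restrict : ∀ {M} → Fin q → List (Partial (suc M)) → List (Partial M)
  restrict x []                  = []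
  restrict x ((nothing ∷ c) ∷ L) = c ∷ restrict x L
  restrict x ((just y ∷ c) ∷ L)  = if does (y ≟ x) then c ∷ restrict x L else restrict x L

  -- Every total extension takes exactly one value at the first coordinate, so the extensions split
  -- according to x.
  totalWeight-restrict : ∀ {M} (L : List (Partial (suc M))) →
    sum (λ x → totalWeight (restrict x L)) ≡ totalWeight L
  totalWeight-restrict []                  = sum-replicate-zero q
  totalWeight-restrict ((nothing ∷ c) ∷ L) =
    trans (∑-distrib-+ (λ _ → weight c) (λ x → totalWeight (restrict x L)))
          (cong₂ _+_ (sum-const q (weight c)) (totalWeight-restrict L))
  totalWeight-restrict ((just y ∷ c) ∷ L)  =
    trans (sum-cong-≗ split)
      (trans (∑-distrib-+ (λ x → if does (y ≟ x) then weight c else 0) (λ x → totalWeight (restrict x L)))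
             (cong₂ _+_ (sum-indicator y (weight c)) (totalWeight-restrict L)))
    where
    split : ∀ x → totalWeight (restrict x ((just y ∷ c) ∷ L)) ≡
      (if does (y ≟ x) then weight c else 0) + totalWeight (restrict x L)
    split x with does (y ≟ x)
    ... | true  = refl
    ... | false = refl

  satisfied violated : ∀ {M} → Vec (Fin q) M → List (Partial M) → List (Partial M)
  satisfied h = filterᵇ (sat h)
  violated h = filterᵇ (not ∘ sat h)

  length-satisfied-∷ : ∀ {M} x (h : Vec (Fin q) M) L →
    length (satisfied (x ∷ h) L) ≡ length (satisfied h (restrict x L))
  length-satisfied-∷ x h []                  = refl
  length-satisfied-∷ x h ((nothing ∷ c) ∷ L) with sat h c
  ... | true  = cong suc (length-satisfied-∷ x h L)
  ... | false = length-satisfied-∷ x h L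
  length-satisfied-∷ x h ((just y ∷ c) ∷ L)  with does (y ≟ x)
  ... | false = length-satisfied-∷ x h L
  ... | true  with sat h c
  ...   | true  = cong suc (length-satisfied-∷ x h L)
  ...   | false = length-satisfied-∷ x h L

  length-violated : ∀ {M} (h : Vec (Fin q) M) L →
    length (violated h L) + length (satisfied h L) ≡ length L
  length-violated h []      = refl
  length-violated h (c ∷ L) with sat h c
  ... | true  = trans (+-suc _ _) (cong suc (length-violated h L))
  ... | false = cong suc (length-violated h L)

  -- The method of conditional expectations.
  choose : ∀ {M} .{{_ : NonZero q}} (L : List (Partial M)) →
    ∃[ h ] totalWeight L ≤ q ^ M * length (satisfied h L)
  choose {zero}  L = [] , ≤-trans (≤-reflexive (empty L)) (≤-reflexive (sym (+-identityʳ _)))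
    where
    empty : (L : List (Partial 0)) → totalWeight L ≡ length (satisfied [] L)
    empty []       = refl
    empty ([] ∷ L) = cong suc (empty L)
  choose {suc M} L
    -- Some first value keeps at least the average share, one q-th, of the total weight.
    with x , p ← sum-≤-max (λ x → totalWeight (restrict x L))
    with h , r ← choose (restrict x L) = x ∷ h , (begin
      totalWeight L                                        ≡⟨ totalWeight-restrict L ⟨
      sum (λ x → totalWeight (restrict x L))               ≤⟨ p ⟩
      q * totalWeight (restrict x L)                       ≤⟨ *-monoʳ-≤ q r ⟩
      q * (q ^ M * length (satisfied h (restrict x L)))    ≡⟨ *-assoc q (q ^ M) _ ⟨
      q ^ suc M * length (satisfied h (restrict x L))      ≡⟨ cong (q ^ suc M *_) (length-satisfied-∷ x h L) ⟨
      q ^ suc M * length (satisfied (x ∷ h) L)             ∎)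
    where open ≤-Reasoning

  -- A partial function with at most k prescribed values is extended by at least a fraction q ^ -k
  -- of all total functions.
  length-*-≤-totalWeight : ∀ {M k} .{{_ : NonZero q}} {L : List (Partial M)} →
    All (λ c → domainSize c ≤ k) L → length L * q ^ M ≤ q ^ k * totalWeight L
  length-*-≤-totalWeight [] = z≤n
  length-*-≤-totalWeight {M} {k} {c ∷ L} (p ∷ ps) = begin
    q ^ M + length L * q ^ M                    ≤⟨ +-mono-≤ single (length-*-≤-totalWeight ps) ⟩
    q ^ k * weight c + q ^ k * totalWeight L    ≡⟨ *-distribˡ-+ (q ^ k) (weight c) (totalWeight L) ⟨
    q ^ k * (weight c + totalWeight L)          ∎
    where
    open ≤-Reasoning
    single : q ^ M ≤ q ^ k * weight c
    single = ≤-trans (≤-reflexive (sym (weight-domainSize c))) (*-monoˡ-≤ (weight c) (^-monoʳ-≤ q p))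

  satisfy-many : ∀ {M k} .{{_ : NonZero q}} (L : List (Partial M)) →
    All (λ c → domainSize c ≤ k) L → ∃[ h ] length L ≤ q ^ k * length (satisfied h L)
  satisfy-many {M} {k} L small with h , p ← choose L = h , *-cancelʳ-≤ _ _ (q ^ M) {{m^n≢0 q M}} (begin
    length L * q ^ M                              ≤⟨ length-*-≤-totalWeight small ⟩
    q ^ k * totalWeight L                         ≤⟨ *-monoʳ-≤ (q ^ k) p ⟩
    q ^ k * (q ^ M * length (satisfied h L))      ≡⟨ x∙yz≈xz∙y (q ^ k) (q ^ M) _ ⟩
    q ^ k * length (satisfied h L) * q ^ M        ∎)
    where open ≤-Reasoning

  -- With a = q ^ k - 1, some function leaves at most the fraction a / (a + 1) = 1 - q ^ -k of L
  -- unextended.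
  violate-few : ∀ {M k a} .{{_ : NonZero q}} → q ^ k ≡ suc a → (L : List (Partial M)) →
    All (λ c → domainSize c ≤ k) L → ∃[ h ] length (violated h L) * suc a ≤ a * length L
  violate-few {k = k} {a} qᵏ L small with h , p ← satisfy-many L small =
    h , +-cancelʳ-≤ (length L) _ _ (begin
      v * suc a + length L        ≤⟨ +-monoʳ-≤ (v * suc a) p ⟩
      v * suc a + q ^ k * s         ≡⟨ cong (λ n → v * suc a + n * s) qᵏ ⟩
      v * suc a + suc a * s       ≡⟨ cong (_+ suc a * s) (*-comm v (suc a)) ⟩
      suc a * v + suc a * s       ≡⟨ *-distribˡ-+ (suc a) v s ⟨
      suc a * (v + s)             ≡⟨ cong (suc a *_) (length-violated h L) ⟩
      length L + a * length L     ≡⟨ +-comm (length L) _ ⟩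
      a * length L + length L     ∎)
    where
    open ≤-Reasoning
    v s : ℕ
    v = length (violated h L)
    s = length (satisfied h L)

  Covers : ∀ {M T} → Vec (Vec (Fin q) M) T → Partial M → Set
  Covers hs c = ∃[ i ] sat (lookup hs i) c ≡ true

  private
    round : ∀ {v l a} t → v * suc a ≤ a * l → l * a ^ suc t < suc a ^ suc t → v * a ^ t < suc a ^ t
    round {v} {l} {a} t few lt = *-cancelˡ-< (suc a) _ _ (begin-strict
      suc a * (v * a ^ t)    ≡⟨ x∙yz≈yx∙z (suc a) v (a ^ t) ⟩
      v * suc a * a ^ t      ≤⟨ *-monoˡ-≤ (a ^ t) few ⟩
      a * l * a ^ t          ≡⟨ xy∙z≈y∙xz a l (a ^ t) ⟩
      l * a ^ suc t          <⟨ lt ⟩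
      suc a ^ suc t          ∎)
      where open ≤-Reasoning

  -- Greedy choice: each function leaves at most a fraction a / (a + 1) of the remaining list. The
  -- numerical hypothesis says that after t rounds fewer than one element is left, hence none.
  cover : ∀ {M k a} .{{_ : NonZero q}} → q ^ k ≡ suc a → ∀ t (L : List (Partial M)) →
    All (λ c → domainSize c ≤ k) L → length L * a ^ t < suc a ^ t →
    ∃[ hs ] (∀ {c} → c ∈ L → Covers {T = t} hs c)
  cover qᵏ zero    []      small lt = [] , λ ()
  cover qᵏ zero    (c ∷ L) small (s≤s ())
  cover {a = a} qᵏ (suc t) L small lt
    with h , few ← violate-few qᵏ L small
    with hs , covers ← cover qᵏ t (violated h L) (All.filter⁺ (T? ∘ not ∘ sat h) small)
           (round {v = length (violated h L)} t few lt)
    = h ∷ hs , covers′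
    where
    covers′ : ∀ {c} → c ∈ L → Covers (h ∷ hs) c
    covers′ {c} c∈ with sat h c in eq
    ... | true  = zero , eq
    ... | false with i , p ← covers (∈-filter⁺ (T? ∘ not ∘ sat h) c∈ (subst (T ∘ not) (sym eq) _)) = suc i , p

  partials : (M k : ℕ) → List (Partial M)
  partials zero    k       = [] ∷ []
  partials (suc M) zero    = map (nothing ∷_) (partials M zero)
  partials (suc M) (suc k) = map (nothing ∷_) (partials M (suc k)) ++
    cartesianProductWith (λ x c → just x ∷ c) (allFin q) (partials M k)

  -- The bound reflects k slots, each either empty or holding one of the q * M pairs of a point and
  -- a value.
  length-partials : (M k : ℕ) → length (partials M k) ≤ suc (q * M) ^ k
  length-partials zero    k       = m^n>0 (suc (q * 0)) k
  length-partials (suc M) zero    = ≤-trans (≤-reflexive (length-map _ (partials M 0))) (length-partials M 0)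
  length-partials (suc M) (suc k) = begin
    length (map (nothing ∷_) (partials M (suc k)) ++ heads)     ≡⟨ length-++ (map (nothing ∷_) (partials M (suc k))) ⟩
    length (map (nothing ∷_) (partials M (suc k))) + length heads
      ≡⟨ cong₂ _+_ (length-map _ (partials M (suc k)))
           (trans (length-cartesianProductWith _ (allFin q) _) (cong (_* length (partials M k)) (length-tabulate {n = q} (λ x → x)))) ⟩
    length (partials M (suc k)) + q * length (partials M k)
      ≤⟨ +-mono-≤ (length-partials M (suc k)) (*-monoʳ-≤ q (length-partials M k)) ⟩
    suc (q * M) * P + q * P           ≡⟨ *-distribʳ-+ P (suc (q * M)) q ⟨
    (suc (q * M) + q) * P             ≡⟨ cong (λ n → suc n * P) (trans (+-comm (q * M) q) (sym (*-suc q M))) ⟩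
    suc (q * suc M) * P               ≤⟨ *-monoʳ-≤ (suc (q * suc M)) (^-monoˡ-≤ k (s≤s (*-monoʳ-≤ q (n≤1+n M)))) ⟩
    suc (q * suc M) ^ suc k           ∎
    where
    open ≤-Reasoning
    heads : List (Partial (suc M))
    heads = cartesianProductWith (λ x c → just x ∷ c) (allFin q) (partials M k)
    P : ℕ
    P = suc (q * M) ^ k

  partials-small : ∀ M k → All (λ c → domainSize c ≤ k) (partials M k)
  partials-small zero    k       = z≤n ∷ []
  partials-small (suc M) zero    = All.map⁺ (partials-small M zero)
  partials-small (suc M) (suc k) = All.++⁺ (All.map⁺ (partials-small M (suc k)))
    (All.cartesianProductWith⁺ (≡.setoid _) (≡.setoid _) _ (allFin q) (partials M k)
      λ _ c∈ → s≤s (All.lookup (partials-small M k) c∈))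

  partials-suc : ∀ M k → partials M k ⊆ partials M (suc k)
  partials-suc zero    k       c∈ = c∈
  partials-suc (suc M) zero    c∈ = ∈-++⁺ˡ (map⁺ _ (partials-suc M zero) c∈)
  partials-suc (suc M) (suc k) c∈ with ∈-++⁻ (map (nothing ∷_) (partials M (suc k))) c∈
  ... | inj₁ c∈′ = ∈-++⁺ˡ (map⁺ _ (partials-suc M (suc k)) c∈′)
  ... | inj₂ c∈′
    with x , c , x∈ , c∈″ , refl ← ∈-cartesianProductWith⁻ (λ x c → just x ∷ c) (allFin q) (partials M k) c∈′
    = ∈-++⁺ʳ _ (∈-cartesianProductWith⁺ (λ x c → just x ∷ c) x∈ (partials-suc M k c∈″))

  partials-mono : ∀ M {j k} → j ≤′ k → partials M j ⊆ partials M k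
  partials-mono M ≤′-refl        c∈ = c∈
  partials-mono M (≤′-step j≤k) c∈ = partials-suc M _ (partials-mono M j≤k c∈)

  partials-update : ∀ M k {c} d x → c ∈ partials M k → c [ d ]≔ just x ∈ partials M (suc k)
  partials-update (suc M) zero zero x c∈ with c , c∈′ , refl ← ∈-map⁻ (nothing ∷_) c∈ =
    ∈-++⁺ʳ _ (∈-cartesianProductWith⁺ (λ x c → just x ∷ c) (∈-allFin x) c∈′)
  partials-update (suc M) zero (suc d) x c∈ with c , c∈′ , refl ← ∈-map⁻ (nothing ∷_) c∈ =
    ∈-++⁺ˡ (∈-map⁺ (nothing ∷_) (partials-update M zero d x c∈′))
  partials-update (suc M) (suc k) d x c∈ with ∈-++⁻ (map (nothing ∷_) (partials M (suc k))) c∈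
  partials-update (suc M) (suc k) zero x c∈ | inj₁ c∈′ with c , c∈″ , refl ← ∈-map⁻ (nothing ∷_) c∈′ =
    ∈-++⁺ʳ _ (∈-cartesianProductWith⁺ (λ x c → just x ∷ c) (∈-allFin x) c∈″)
  partials-update (suc M) (suc k) (suc d) x c∈ | inj₁ c∈′ with c , c∈″ , refl ← ∈-map⁻ (nothing ∷_) c∈′ =
    ∈-++⁺ˡ (∈-map⁺ (nothing ∷_) (partials-update M (suc k) d x c∈″))
  partials-update (suc M) (suc k) d x c∈ | inj₂ c∈′
    with y , c , y∈ , c∈″ , refl ← ∈-cartesianProductWith⁻ (λ x c → just x ∷ c) (allFin q) (partials M k) c∈′
    with d
  -- The first coordinate was already defined, so overwriting it leaves the domain size unchanged,
  -- and the tail only has to be lifted to the larger bound.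
  ... | zero   = ∈-++⁺ʳ _ (∈-cartesianProductWith⁺ (λ x c → just x ∷ c) (∈-allFin x) (partials-suc M k c∈″))
  ... | suc d′ = ∈-++⁺ʳ _ (∈-cartesianProductWith⁺ (λ x c → just x ∷ c) y∈ (partials-update M k d′ x c∈″))

  -- A point repeated in D is assigned the same value each time, so D need not be free of
  -- repetitions.
  pin : ∀ {M} → List (Fin M) → (Fin M → Fin q) → Partial M
  pin []      ℓ = replicate _ nothing
  pin (d ∷ D) ℓ = pin D ℓ [ d ]≔ just (ℓ d)

  pin∈partials : ∀ {M} (D : List (Fin M)) ℓ → pin D ℓ ∈ partials M (length D)
  pin∈partials {M} []      ℓ = none M
    where
    none : ∀ M → replicate M nothing ∈ partials M 0
    none zero    = here refl
    none (suc M) = ∈-map⁺ (nothing ∷_) (none M)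
  pin∈partials {M} (d ∷ D) ℓ = partials-update M (length D) d (ℓ d) (pin∈partials D ℓ)

  lookup-pin : ∀ {M} {D : List (Fin M)} (ℓ : Fin M → Fin q) {d} → d ∈ D → lookup (pin D ℓ) d ≡ just (ℓ d)
  lookup-pin {D = d′ ∷ D} ℓ {d} d∈ with d ≟ d′
  ... | yes refl = lookup∘update d (pin D ℓ) (just (ℓ d))
  lookup-pin {D = d′ ∷ D} ℓ {d} (here refl) | no ne = contradiction refl ne
  lookup-pin {D = d′ ∷ D} ℓ {d} (there d∈)  | no ne =
    trans (lookup∘update′ ne (pin D ℓ) (just (ℓ d′))) (lookup-pin ℓ d∈)

  cover⇒universal : ∀ {k M T} (hs : Vec (Vec (Fin q) M) T) →
    (∀ {c} → c ∈ partials M k → Covers hs c) → Universal k q M T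
  cover⇒universal {k} {M} hs covers = (λ i d → lookup (lookup hs i) d) , λ D D≤k ℓ →
    let i , s = covers (partials-mono M (≤⇒≤′ D≤k) (pin∈partials D ℓ))
    in i , λ {d} d∈ → sat-lookup (lookup hs i) (pin D ℓ) d s (lookup-pin ℓ d∈)

-- Bernoulli's inequality 1 + j / n ≤ (1 + 1 / n) ^ j, cleared of denominators.
n^j*[n+j]≤[1+n]^j*n : ∀ n j → n ^ j * (n + j) ≤ suc n ^ j * n
n^j*[n+j]≤[1+n]^j*n n zero    = ≤-reflexive (cong (1 *_) (+-identityʳ n))
n^j*[n+j]≤[1+n]^j*n n (suc j) = begin
  n * n ^ j * (n + suc j)           ≡⟨ xy∙z≈y∙xz n (n ^ j) (n + suc j) ⟩
  n ^ j * (n * (n + suc j))         ≡⟨ cong (λ m → n ^ j * (n * m)) (+-suc n j) ⟩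
  n ^ j * (n * suc (n + j))         ≡⟨ cong (n ^ j *_) (*-suc n (n + j)) ⟩
  n ^ j * (n + n * (n + j))         ≤⟨ *-monoʳ-≤ (n ^ j) (+-monoˡ-≤ (n * (n + j)) (m≤m+n n j)) ⟩
  n ^ j * (suc n * (n + j))         ≡⟨ x∙yz≈y∙xz (n ^ j) (suc n) (n + j) ⟩
  suc n * (n ^ j * (n + j))         ≤⟨ *-monoʳ-≤ (suc n) (n^j*[n+j]≤[1+n]^j*n n j) ⟩
  suc n * (suc n ^ j * n)           ≡⟨ *-assoc (suc n) (suc n ^ j) n ⟨
  suc n ^ suc j * n                 ∎
  where open ≤-Reasoning

-- Bernoulli with exponent n + 1 gives (1 + 1 / n) ^ (n + 1) ≥ 2 + 1 / n. The factor 2 serves both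
-- the covering argument and the approximation of logarithms by rationals.
2*n^[1+n]<[1+n]^[1+n] : ∀ n → 2 * n ^ suc n < suc n ^ suc n
2*n^[1+n]<[1+n]^[1+n] zero      = s≤s z≤n
2*n^[1+n]<[1+n]^[1+n] n@(suc _) = *-cancelʳ-< n _ _ (begin-strict
  2 * n ^ suc n * n                 ≡⟨ xy∙z≈y∙zx 2 (n ^ suc n) n ⟩
  n ^ suc n * (n * 2)               <⟨ *-monoʳ-< (n ^ suc n) {{m^n≢0 n (suc n)}} (s≤s (≤-reflexive n*2)) ⟩
  n ^ suc n * suc (n + n)           ≡⟨ cong (n ^ suc n *_) (+-suc n n) ⟨
  n ^ suc n * (n + suc n)           ≤⟨ n^j*[n+j]≤[1+n]^j*n n (suc n) ⟩
  suc n ^ suc n * n                 ∎)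
  where
  open ≤-Reasoning
  n*2 : n * 2 ≡ n + n
  n*2 = trans (*-comm n 2) (cong (λ l → n + l) (+-identityʳ n))

-- With a + 1 = q ^ k, a block of q ^ k greedy rounds more than halves the list, since 2 * a ^ (a +
-- 1) < (a + 1) ^ (a + 1). So s + 1 blocks exhaust at most 2 ^ (s + 1) partial functions; the
-- positive number of blocks keeps the inequality strict.
universal-exists : ∀ {q} .{{_ : NonZero q}} k M s → suc (q * M) ^ k ≤ 2 ^ suc s →
  Universal k q M (q ^ k * suc s)
universal-exists {q} k M s le with q ^ k in qᵏ
... | zero  = contradiction qᵏ (≢-nonZero⁻¹ (q ^ k) {{m^n≢0 q k}})
... | suc a =
  let hs , covers = cover qᵏ (suc a * suc s) (partials {q} M k) (partials-small M k) (begin-strict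
        length (partials {q} M k) * a ^ (suc a * suc s)
          ≤⟨ *-monoˡ-≤ (a ^ (suc a * suc s)) (≤-trans (length-partials {q} M k) le) ⟩
        2 ^ suc s * a ^ (suc a * suc s)           ≡⟨ cong (2 ^ suc s *_) (^-*-assoc a (suc a) (suc s)) ⟨
        2 ^ suc s * (a ^ suc a) ^ suc s           ≡⟨ ^-distribʳ-* (suc s) 2 (a ^ suc a) ⟨
        (2 * a ^ suc a) ^ suc s                   <⟨ ^-monoˡ-< (suc s) (2*n^[1+n]<[1+n]^[1+n] a) ⟩
        (suc a ^ suc a) ^ suc s                   ≡⟨ ^-*-assoc (suc a) (suc a) (suc s) ⟩
        suc a ^ (suc a * suc s)                   ∎)
  in cover⇒universal hs covers
  where open ≤-Reasoning

-- Counting colours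

tower : ℕ → ℕ → ℕ
tower zero    b = b
tower (suc k) b = 2 ^ tower k b

tower-+ : ∀ j k b → tower (j + k) b ≡ tower j (tower k b)
tower-+ zero    k b = refl
tower-+ (suc j) k b = cong (2 ^_) (tower-+ j k b)

tower-mono : ∀ k {a b} → a ≤ b → tower k a ≤ tower k b
tower-mono zero    a≤b = a≤b
tower-mono (suc k) a≤b = ^-monoʳ-≤ 2 (tower-mono k a≤b)

tower-double : ∀ δ b → tower (2 * suc δ) b ≡ 2 ^ (2 ^ tower (2 * δ) b)
tower-double δ b = cong (λ k → tower k b) (*-suc 2 δ)

1+n≤2^n : ∀ n → suc n ≤ 2 ^ n
1+n≤2^n zero    = ≤-refl
1+n≤2^n (suc n) = begin
  suc (suc n)          ≡⟨ +-comm 1 (suc n) ⟩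
  suc n + 1            ≤⟨ +-mono-≤ (1+n≤2^n n) (m^n>0 2 n) ⟩
  2 ^ n + 2 ^ n        ≡⟨ cong (λ l → 2 ^ n + l) (+-identityʳ (2 ^ n)) ⟨
  2 ^ suc n            ∎
  where open ≤-Reasoning

b≤tower : ∀ k b → b ≤ tower k b
b≤tower zero    b = ≤-refl
b≤tower (suc k) b = ≤-trans (b≤tower k b) (≤-trans (n≤1+n _) (1+n≤2^n (tower k b)))

[2+r]²≤2^[2+2r] : ∀ r → (2 + r) * (2 + r) ≤ 2 ^ (2 + 2 * r)
[2+r]²≤2^[2+2r] r = begin
  (2 + r) * (2 + r)            ≤⟨ *-mono-≤ (1+n≤2^n (suc r)) (1+n≤2^n (suc r)) ⟩
  2 ^ suc r * 2 ^ suc r        ≡⟨ ^-distribˡ-+-* 2 (suc r) (suc r) ⟨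
  2 ^ (suc r + suc r)          ≡⟨ cong (2 ^_) (solve 1 (λ r → (con 1 :+ r) :+ (con 1 :+ r) := con 2 :+ con 2 :* r) refl r) ⟩
  2 ^ (2 + 2 * r)              ∎
  where open ≤-Reasoning

-- With y = 2 ^ r this bounds the exponents in step-count for 2 + r.
quadratic : ∀ y → 1 ≤ y → suc y * suc (y + y) + 4 * (y * y) ≤ 4 * (2 * (2 * y) * (2 * (2 * y)))
quadratic y 1≤y = begin
  suc y * suc (y + y) + 4 * (y * y)        ≤⟨ +-monoˡ-≤ (4 * (y * y)) (*-mono-≤ (+-monoˡ-≤ y 1≤y) (+-monoˡ-≤ (y + y) 1≤y)) ⟩
  (y + y) * (y + (y + y)) + 4 * (y * y)
    ≡⟨ solve 1 (λ y → (y :+ y) :* (y :+ (y :+ y)) :+ con 4 :* (y :* y) := con 10 :* (y :* y)) refl y ⟩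
  10 * (y * y)                             ≤⟨ *-monoˡ-≤ (y * y) (m≤m+n 10 54) ⟩
  64 * (y * y)
    ≡⟨ solve 1 (λ y → con 64 :* (y :* y) := con 4 :* (con 2 :* (con 2 :* y) :* (con 2 :* (con 2 :* y)))) refl y ⟩
  4 * (2 * (2 * y) * (2 * (2 * y)))        ∎
  where open ≤-Reasoning

-- The factor that one step adds to the labels is paid for by the drop of the size bound from r to r
-- - 2. This is what keeps the constant independent of δ.
step-count : ∀ r → suc r * (2 ^ r) ^ (2 ^ (r ∸ 1 ∸ 1)) * bigC (r ∸ 1 ∸ 1) ≤ bigC r
step-count r = begin
  suc r * (2 ^ r) ^ x * bigC r′                ≤⟨ *-monoˡ-≤ (bigC r′) (*-monoˡ-≤ ((2 ^ r) ^ x) (1+n≤2^n r)) ⟩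
  2 ^ r * (2 ^ r) ^ x * bigC r′                ≡⟨ cong (λ n → 2 ^ r * n * bigC r′) (^-*-assoc 2 r x) ⟩
  2 ^ r * 2 ^ (r * x) * bigC r′                ≡⟨ cong (_* bigC r′) (^-distribˡ-+-* 2 r (r * x)) ⟨
  2 ^ (r + r * x) * bigC r′                    ≡⟨ ^-distribˡ-+-* 2 (r + r * x) (2 ^ (2 + 2 * r′)) ⟨
  2 ^ (r + r * x + 2 ^ (2 + 2 * r′))           ≤⟨ ^-monoʳ-≤ 2 (exponent r) ⟩
  bigC r                                       ∎
  where
  open ≤-Reasoning
  r′ x : ℕ
  r′ = r ∸ 1 ∸ 1
  x = 2 ^ r′

  square : ∀ r → 2 ^ (2 + 2 * r) ≡ 4 * (2 ^ r * 2 ^ r)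
  square r = trans (^-distribˡ-+-* 2 2 (2 * r))
    (cong (4 *_) (trans (cong (2 ^_) (cong (λ l → r + l) (+-identityʳ r))) (^-distribˡ-+-* 2 r r)))

  exponent : ∀ r → r + r * 2 ^ (r ∸ 1 ∸ 1) + 2 ^ (2 + 2 * (r ∸ 1 ∸ 1)) ≤ 2 ^ (2 + 2 * r)
  exponent zero          = ≤-refl
  exponent (suc zero)    = m≤m+n 6 10
  exponent (suc (suc r)) = begin
    2 + r + (2 + r) * y + 2 ^ (2 + 2 * r)              ≡⟨ cong₂ _+_ (sym (*-suc (2 + r) y)) (square r) ⟩
    (2 + r) * suc y + 4 * (y * y)                      ≤⟨ +-monoˡ-≤ (4 * (y * y)) (*-mono-≤ (s≤s (1+n≤2^n r)) (s≤s (m≤m+n y y))) ⟩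
    suc y * suc (y + y) + 4 * (y * y)                  ≤⟨ quadratic y (m^n>0 2 r) ⟩
    4 * (2 * (2 * y) * (2 * (2 * y)))                  ≡⟨ square (2 + r) ⟨
    2 ^ (2 + 2 * (2 + r))                              ∎
    where
    y : ℕ
    y = 2 ^ r

-- The left side is the number of colours per label when δ = 1. It is linear in a, and 1 ≤ a lets
-- the constant term be absorbed into a multiple of a.
base-count : ∀ r a → 1 ≤ a →
  suc r * ((2 ^ r) ^ r * suc (suc (r + suc a) * r)) ≤ bigC r * a
base-count r a 1≤a = begin
  suc r * ((2 ^ r) ^ r * suc (suc (r + suc a) * r))
    ≤⟨ *-mono-≤ (1+n≤2^n r) (*-mono-≤ (≤-reflexive (^-*-assoc 2 r r)) linear) ⟩
  2 ^ r * (2 ^ (r * r) * ((2 + r) * (2 + r) * a))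
    ≤⟨ *-monoʳ-≤ (2 ^ r) (*-monoʳ-≤ (2 ^ (r * r)) (*-monoˡ-≤ a ([2+r]²≤2^[2+2r] r))) ⟩
  2 ^ r * (2 ^ (r * r) * (2 ^ (2 + 2 * r) * a))
    ≡⟨ cong (2 ^ r *_) (*-assoc (2 ^ (r * r)) _ a) ⟨
  2 ^ r * (2 ^ (r * r) * 2 ^ (2 + 2 * r) * a)
    ≡⟨ *-assoc (2 ^ r) _ a ⟨
  2 ^ r * (2 ^ (r * r) * 2 ^ (2 + 2 * r)) * a
    ≡⟨ cong (λ n → 2 ^ r * n * a) (^-distribˡ-+-* 2 (r * r) (2 + 2 * r)) ⟨
  2 ^ r * 2 ^ (r * r + (2 + 2 * r)) * a
    ≡⟨ cong (_* a) (^-distribˡ-+-* 2 r (r * r + (2 + 2 * r))) ⟨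
  2 ^ (r + (r * r + (2 + 2 * r))) * a
    ≤⟨ *-monoˡ-≤ a (^-monoʳ-≤ 2 (≤-trans (≤-trans (m≤m+n _ (2 + r)) (≤-reflexive exponent)) ([2+r]²≤2^[2+2r] r))) ⟩
  bigC r * a ∎
  where
  open ≤-Reasoning
  exponent : r + (r * r + (2 + 2 * r)) + (2 + r) ≡ (2 + r) * (2 + r)
  exponent = solve 1 (λ r → r :+ (r :* r :+ (con 2 :+ con 2 :* r)) :+ (con 2 :+ r) :=
    (con 2 :+ r) :* (con 2 :+ r)) refl r
  linear : suc (suc (r + suc a) * r) ≤ (2 + r) * (2 + r) * a
  linear = begin
    suc (suc (r + suc a) * r)
      ≡⟨ solve 2 (λ r a → con 1 :+ (con 1 :+ (r :+ (con 1 :+ a))) :* r :=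
           (con 1 :+ r :* r :+ con 2 :* r) :* con 1 :+ r :* a) refl r a ⟩
    (1 + r * r + 2 * r) * 1 + r * a               ≤⟨ +-monoˡ-≤ (r * a) (*-monoʳ-≤ (1 + r * r + 2 * r) 1≤a) ⟩
    (1 + r * r + 2 * r) * a + r * a               ≤⟨ m≤m+n _ ((3 + r) * a) ⟩
    (1 + r * r + 2 * r) * a + r * a + (3 + r) * a
      ≡⟨ solve 2 (λ r a → (con 1 :+ r :* r :+ con 2 :* r) :* a :+ r :* a :+ (con 3 :+ r) :* a :=
           (con 2 :+ r) :* (con 2 :+ r) :* a) refl r a ⟩
    (2 + r) * (2 + r) * a                         ∎

-- There are at most (1 + 2 ^ (r + b)) ^ r ≤ 2 ^ ((1 + r + b) * r) partial functions to cover, so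
-- the family size is linear in b, the logarithm of the number of points.
universal-tower : ∀ r b → Universal r (2 ^ r) (2 ^ b) ((2 ^ r) ^ r * suc (suc (r + b) * r))
universal-tower r b = universal-exists {{m^n≢0 2 r}} r (2 ^ b) (suc (r + b) * r) (begin
  suc (2 ^ r * 2 ^ b) ^ r         ≡⟨ cong (λ n → suc n ^ r) (^-distribˡ-+-* 2 r b) ⟨
  suc (2 ^ (r + b)) ^ r           ≤⟨ ^-monoˡ-≤ r 1+2^n≤2^[1+n] ⟩
  (2 ^ suc (r + b)) ^ r           ≡⟨ ^-*-assoc 2 (suc (r + b)) r ⟩
  2 ^ (suc (r + b) * r)           ≤⟨ ^-monoʳ-≤ 2 (n≤1+n (suc (r + b) * r)) ⟩
  2 ^ suc (suc (r + b) * r)       ∎)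
  where
  open ≤-Reasoning
  1+2^n≤2^[1+n] : suc (2 ^ (r + b)) ≤ 2 ^ suc (r + b)
  1+2^n≤2^[1+n] = +-mono-≤ (m^n>0 2 (r + b)) (≤-reflexive (sym (+-identityʳ _)))

-- Induction on δ with Q and r varying: a step multiplies Q and lowers r, and `step-count` balances
-- the two. The tower over a + 1 against the count with a leaves room for rounding the iterated
-- logarithm.
tower-colouring : ∀ δ Q r a → 1 ≤ a →
  ∃[ N ] (N ≤ Q * (bigC r * a) × Colouring Q r (tower (2 * suc δ) (suc a)) (suc δ) N)
tower-colouring zero Q r a 1≤a =
  _ , *-monoʳ-≤ Q (base-count r a 1≤a) , base-colouring (universal-tower r (suc a))
tower-colouring (suc δ) Q r a 1≤a
  with N , N≤ , colouring ← tower-colouring δ (Q * (suc r * (2 ^ r) ^ (2 ^ (r ∸ 1 ∸ 1)))) (r ∸ 1 ∸ 1) a 1≤a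
  = N , ≤-trans N≤ count , subst (λ n → Colouring Q r n (2 + δ) N) (sym (tower-double (suc δ) (suc a)))
      (step-colouring (tower (2 * suc δ) (suc a)) colouring)
  where
  open ≤-Reasoning
  K = suc r * (2 ^ r) ^ (2 ^ (r ∸ 1 ∸ 1))
  c = bigC (r ∸ 1 ∸ 1)
  count : Q * K * (c * a) ≤ Q * (bigC r * a)
  count = begin
    Q * K * (c * a)      ≡⟨ *-assoc Q K (c * a) ⟩
    Q * (K * (c * a))    ≡⟨ cong (Q *_) (*-assoc K c a) ⟨
    Q * (K * c * a)      ≤⟨ *-monoʳ-≤ Q (*-monoˡ-≤ a (step-count r)) ⟩
    Q * (bigC r * a)     ∎

-- Vertices of U(m, R, δ) as states

elements : ∀ {n} → Subset n → List (Fin n)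
elements []            = []
elements (inside  ∷ p) = zero ∷ map suc (elements p)
elements (outside ∷ p) = map suc (elements p)

length-elements : ∀ {n} (p : Subset n) → length (elements p) ≡ ∣ p ∣
length-elements []            = refl
length-elements (inside  ∷ p) = cong suc (trans (length-map suc (elements p)) (length-elements p))
length-elements (outside ∷ p) = trans (length-map suc (elements p)) (length-elements p)

∈-elements⁺ : ∀ {n} {p : Subset n} {x} → x ∈ₛ p → x ∈ elements p
∈-elements⁺ {p = inside  ∷ p} here       = here refl
∈-elements⁺ {p = inside  ∷ p} (there x∈) = there (∈-map⁺ suc (∈-elements⁺ x∈))
∈-elements⁺ {p = outside ∷ p} (there x∈) = ∈-map⁺ suc (∈-elements⁺ x∈)

∈-elements⁻ : ∀ {n} {p : Subset n} {x} → x ∈ elements p → x ∈ₛ p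
∈-elements⁻ {p = inside  ∷ p} (here refl) = here
∈-elements⁻ {p = inside  ∷ p} (there x∈) with _ , y∈ , refl ← ∈-map⁻ suc x∈ = there (∈-elements⁻ y∈)
∈-elements⁻ {p = outside ∷ p} x∈         with _ , y∈ , refl ← ∈-map⁻ suc x∈ = there (∈-elements⁻ y∈)

elements-mono : ∀ {n} {p q : Subset n} → p ⊆ₛ q → elements p ⊆ elements q
elements-mono p⊆q x∈ = ∈-elements⁺ (p⊆q (∈-elements⁻ x∈))

nested : ∀ {m f} (A : Fin (suc f) → Subset m) → (∀ i → A (inject₁ i) ⊆ₛ A (suc i)) →
  ∀ {i j} → toℕ i ≤ toℕ j → A i ⊆ₛ A j
nested             A mono {zero}  {zero}  _       x∈ = x∈
nested {f = suc f} A mono {zero}  {suc j} _       x∈ = nested (A ∘ suc) (mono ∘ suc) {zero} {j} z≤n (mono zero x∈)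
nested {f = suc f} A mono {suc i} {suc j} (s≤s p) x∈ = nested (A ∘ suc) (mono ∘ suc) p x∈

-- Continues a chain beyond its last index δ as a constant sequence.
clamp : ∀ δ → ℕ → Fin (suc δ)
clamp δ i = fromℕ< (s≤s (m⊓n≤n i δ))

toℕ-clamp : ∀ δ i → toℕ (clamp δ i) ≡ i ⊓ δ
toℕ-clamp δ i = toℕ-fromℕ< (s≤s (m⊓n≤n i δ))

toℕ-clamp-≤ : ∀ {δ i} → i ≤ δ → toℕ (clamp δ i) ≡ i
toℕ-clamp-≤ {δ} {i} i≤δ = trans (toℕ-clamp δ i) (m≤n⇒m⊓n≡m i≤δ)

module _ {m n R δ : ℕ} (m≤n : m ≤ n) where

  private
    level : UVertex m R δ → ℕ → Subset m
    level (u , _) i = Chain.A u (clamp δ i)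

    embed : Fin m → Fin n
    embed x = inject≤ x m≤n

  toState : UVertex m R δ → State 1 R n
  toState u@(chain , small) = record
    { label = zero
    ; X     = λ i → map embed (elements (level u i))
    ; bound = λ i → ≤-trans (≤-reflexive (trans (length-map embed (elements (level u i))) (length-elements (level u i))))
        (≤-trans (p⊆q⇒∣p∣≤∣q∣ (nested (Chain.A chain) (Chain.mono chain) (clamp≤δ i))) small)
    ; grow  = λ i → map⁺ embed (elements-mono (nested (Chain.A chain) (Chain.mono chain) (clamp-mono i)))
    }
    where
    clamp≤δ : ∀ i → toℕ (clamp δ i) ≤ toℕ (fromℕ δ)
    clamp≤δ i = ≤-trans (≤-reflexive (toℕ-clamp δ i)) (≤-trans (m⊓n≤n i δ) (≤-reflexive (sym (toℕ-fromℕ δ))))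

    clamp-mono : ∀ i → toℕ (clamp δ i) ≤ toℕ (clamp δ (suc i))
    clamp-mono i = ≤-trans (≤-reflexive (toℕ-clamp δ i))
      (≤-trans (⊓-monoˡ-≤ δ (n≤1+n i)) (≤-reflexive (sym (toℕ-clamp δ (suc i)))))

  toState-adj : ∀ u v → UAdj u v → Adj δ (toState u) (toState v)
  toState-adj u@(a , _) v@(b , _) (α≢β , α∈ , β∈ , sub) = record
    { distinct = λ (_ , eq) → α≢β (α-determined eq)
    ; fwd      = λ i i<δ → map⁺ embed (elements-mono (forward i i<δ))
    ; bwd      = λ i i<δ → map⁺ embed (elements-mono (backward i i<δ))
    }
    where
    α∈level₀ : Chain.α a ∈ₛ level u 0
    α∈level₀ = subst (Chain.α a ∈ₛ_) (sym (Chain.A₀ a)) (x∈⁅x⁆ (Chain.α a))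

    α-determined : map embed (elements (level u 0)) ≡ map embed (elements (level v 0)) → Chain.α a ≡ Chain.α b
    α-determined eq
      with x , x∈ , embed≡ ← ∈-map⁻ embed (subst (embed (Chain.α a) ∈_) eq (∈-map⁺ embed (∈-elements⁺ α∈level₀)))
      = trans (inject≤-injective m≤n m≤n (Chain.α a) x embed≡)
          (x∈⁅y⁆⇒x≡y (Chain.α b) (subst (x ∈ₛ_) (Chain.A₀ b) (∈-elements⁻ x∈)))

    singleton⊆ : ∀ {w x} {p : Subset m} → Chain.A w zero ≡ ⁅ x ⁆ → x ∈ₛ p → Chain.A w zero ⊆ₛ p
    singleton⊆ {x = x} A₀ x∈ y∈ with refl ← x∈⁅y⁆⇒x≡y x (subst (_ ∈ₛ_) A₀ y∈) = x∈

    indices : ∀ i → suc i < δ → 1 ≤ toℕ (clamp δ (suc i)) × toℕ (clamp δ (2 + i)) ≡ suc (toℕ (clamp δ (suc i)))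
    indices i i<δ = ≤-trans (s≤s z≤n) (≤-reflexive (sym (toℕ-clamp-≤ (<⇒≤ i<δ)))) ,
      trans (toℕ-clamp-≤ i<δ) (cong suc (sym (toℕ-clamp-≤ (<⇒≤ i<δ))))

    forward : ∀ i → i < δ → level u i ⊆ₛ level v (suc i)
    -- As A₀ = {α}, the inclusion at index 0 is the condition α ∈ B₁.
    forward zero    0<δ = singleton⊆ {a} (Chain.A₀ a) (α∈ (clamp δ 1) (toℕ-clamp-≤ 0<δ))
    forward (suc i) i<δ with p , q ← indices i i<δ = proj₁ (sub (clamp δ (suc i)) (clamp δ (2 + i)) p q)

    backward : ∀ i → i < δ → level v i ⊆ₛ level u (suc i)
    backward zero    0<δ = singleton⊆ {b} (Chain.A₀ b) (β∈ (clamp δ 1) (toℕ-clamp-≤ 0<δ))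
    backward (suc i) i<δ with p , q ← indices i i<δ = proj₂ (sub (clamp δ (suc i)) (clamp δ (2 + i)) p q)

  toProperColouring : ∀ {N N′} → N ≤ N′ → Colouring 1 R n δ N → ProperColouring m R δ N′
  toProperColouring N≤N′ (c , proper) = (λ u → inject≤ (c (toState u)) N≤N′) ,
    λ u v adj eq → proper (toState u) (toState v) (toState-adj u v adj)
      (inject≤-injective N≤N′ N≤N′ (c (toState u)) (c (toState v)) eq)

-- Iterated logarithms as towers

fromNat : ℕ → ℚ
fromNat n = mkℚ (+ n) 0 (Coprime.sym (Coprime.1-coprimeTo n))

/1≡fromNat : ∀ n → + n / 1 ≡ fromNat n
/1≡fromNat n = ℚ.normalize-coprime (Coprime.sym (Coprime.1-coprimeTo n))

-- Turns `ratio N R` into the integer a when N = `bigC R` * a.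
c*a/c≡a/1 : ∀ c a .{{_ : NonZero c}} → + (c * a) / c ≡ + a / 1
c*a/c≡a/1 (suc c) a = ℚ.fromℚᵘ-cong {mkℚᵘ (+ (suc c * a)) c} {mkℚᵘ (+ a) 0} (*≡* (begin
  + (suc c * a) ℤ.* + 1    ≡⟨ ℤ.*-identityʳ _ ⟩
  + (suc c * a)            ≡⟨ cong +_ (*-comm (suc c) a) ⟩
  + (a * suc c)            ≡⟨ ℤ.pos-* a (suc c) ⟩
  + a ℤ.* + suc c          ∎))
  where open ≡-Reasoning

nat-<⁺ : ∀ {n d T} .{c : Coprime.Coprime n (suc d)} → n < T * suc d → mkℚ (+ n) d c ℚ.< fromNat T
nat-<⁺ {n} {d} {T} lt = *<* (subst₂ ℤ._<_ (sym (ℤ.*-identityʳ (+ n))) (ℤ.pos-* T (suc d)) (ℤ.+<+ lt))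

nat-<⁻ : ∀ {n d T} .{c : Coprime.Coprime n (suc d)} → mkℚ (+ n) d c ℚ.< fromNat T → n < T * suc d
nat-<⁻ {n} {d} {T} (*<* lt) =
  ℤ.drop‿+<+ (subst₂ ℤ._<_ (ℤ.*-identityʳ (+ n)) (sym (ℤ.pos-* T (suc d))) lt)

^-cancelˡ-< : ∀ n {a b} → a ^ n < b ^ n → a < b
^-cancelˡ-< n lt = ≰⇒> λ b≤a → <⇒≱ lt (^-monoˡ-≤ n b≤a)

-- For positive t with denominator s, the s-th powers of x and 2 ^ T are compared and the exponent
-- cancelled. For negative t already x < 1.
PowLt-<-tower : ∀ {x t T} → PowLt x t → t ℚ.< fromNat T → x ℚ.< fromNat (2 ^ T)
PowLt-<-tower {mkℚ -[1+ _ ] _ _} {T = T} _ _ = *<* (subst (-[1+ _ ] ℤ.<_) (ℤ.pos-* (2 ^ T) _) ℤ.-<+)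
PowLt-<-tower {mkℚ (+ n) d _} {mkℚ (+ p) s-1 _} {T} pow t<T = nat-<⁺ (^-cancelˡ-< s (begin-strict
  n ^ s                        <⟨ pow ⟩
  2 ^ p * suc d ^ s            ≤⟨ *-monoˡ-≤ (suc d ^ s) (^-monoʳ-≤ 2 (<⇒≤ (nat-<⁻ t<T))) ⟩
  2 ^ (T * s) * suc d ^ s      ≡⟨ cong (_* suc d ^ s) (^-*-assoc 2 T s) ⟨
  (2 ^ T) ^ s * suc d ^ s      ≡⟨ ^-distribʳ-* s (2 ^ T) (suc d) ⟨
  (2 ^ T * suc d) ^ s          ∎))
  where
  open ≤-Reasoning
  s : ℕ
  s = suc s-1
PowLt-<-tower {mkℚ (+ n) d _} {mkℚ -[1+ p ] s-1 _} {T} pow _ = nat-<⁺ (^-cancelˡ-< s (begin-strict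
  n ^ s                        ≤⟨ m≤m*n (n ^ s) (2 ^ suc p) {{m^n≢0 2 (suc p)}} ⟩
  n ^ s * 2 ^ suc p            <⟨ pow ⟩
  suc d ^ s                    ≤⟨ ^-monoˡ-≤ s (m≤n*m (suc d) (2 ^ T) {{m^n≢0 2 T}}) ⟩
  (2 ^ T * suc d) ^ s          ∎))
  where
  open ≤-Reasoning
  s : ℕ
  s = suc s-1

Below⇒<-tower : ∀ k a {x} → Below k x (fromNat a) → x ℚ.< fromNat (tower k a)
Below⇒<-tower zero    a x<a = x<a
Below⇒<-tower (suc k) a (inj₁ x≤0) = ℚ.≤-<-trans x≤0 (nat-<⁺ (≤-trans (m^n>0 2 (tower k a)) (≤-reflexive (sym (*-identityʳ _)))))
Below⇒<-tower (suc k) a (inj₂ (_ , _ , t<a , pow)) = PowLt-<-tower pow (Below⇒<-tower k a t<a)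

-- If n / d < 2 ^ (1 + T) with n > 0, then t = (1 + T) − 1 / (1 + n) still satisfies n / d < 2 ^ t;
-- its numerator and denominator are automatically coprime.
<-tower⇒Below : ∀ k {a x} → 1 ≤ a → x ℚ.< fromNat (tower k a) → Below k x (fromNat a)
<-tower⇒Below zero    1≤a x<a = x<a
<-tower⇒Below (suc k) {x = mkℚ -[1+ _ ] _ _} 1≤a x< = inj₁ (*≤* ℤ.-≤+)
<-tower⇒Below (suc k) {x = mkℚ (+ zero) _ _} 1≤a x< = inj₁ (*≤* ℤ.≤-refl)
<-tower⇒Below (suc k) {a} {mkℚ (+ n@(suc _)) d _} 1≤a x<
  with tower k a in eq
... | zero  = contradiction (≤-trans 1≤a (≤-trans (b≤tower k a) (≤-reflexive eq))) λ ()
... | suc T = inj₂ (*<* (ℤ.+<+ (s≤s z≤n)) , t , <-tower⇒Below k 1≤a t< , pow)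
  where
  open ≤-Reasoning
  s = suc n
  cop : Coprime.Coprime (T * s + n) s
  cop {e} (e∣ , e∣s) = ∣1⇒≡1 (∣m+n∣m⇒∣n (subst (e ∣_) (+-comm 1 n) e∣s) (∣m+n∣m⇒∣n e∣ (∣n⇒∣m*n T e∣s)))

  t : ℚ
  t = mkℚ (+ (T * s + n)) n cop

  t< : t ℚ.< fromNat (tower k a)
  t< = nat-<⁺ (begin-strict
    T * s + n          ≡⟨ +-comm (T * s) n ⟩
    n + T * s          <⟨ ≤-refl ⟩
    suc T * s          ≡⟨ cong (_* s) eq ⟨
    tower k a * s      ∎)

  -- Being an integer inequality, n < 2 ^ (1 + T) * d leaves room for n + 1 on the left. Passing
  -- from n to n + 1 gains a factor 2 in the s-th power, exactly what lowering the exponent 1 + T by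
  -- 1 / s costs.
  pow : n ^ s < 2 ^ (T * s + n) * suc d ^ s
  pow = *-cancelˡ-< 2 _ _ (begin-strict
    2 * n ^ s                              <⟨ 2*n^[1+n]<[1+n]^[1+n] n ⟩
    s ^ s                                  ≤⟨ ^-monoˡ-≤ s (nat-<⁻ x<) ⟩
    (2 ^ suc T * suc d) ^ s                ≡⟨ ^-distribʳ-* s (2 ^ suc T) (suc d) ⟩
    (2 ^ suc T) ^ s * suc d ^ s            ≡⟨ cong (_* suc d ^ s) (^-*-assoc 2 (suc T) s) ⟩
    2 ^ (suc n + T * s) * suc d ^ s        ≡⟨ cong (λ e → 2 ^ suc e * suc d ^ s) (+-comm n (T * s)) ⟩
    2 * 2 ^ (T * s + n) * suc d ^ s        ≡⟨ *-assoc 2 (2 ^ (T * s + n)) (suc d ^ s) ⟩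
    2 * (2 ^ (T * s + n) * suc d ^ s)      ∎)

LogIterGe⇒tower≤ : ∀ k m {a} → 1 ≤ a → LogIterGe k m (+ a / 1) → tower k a ≤ m
LogIterGe⇒tower≤ k m {a} 1≤a ge = ≮⇒≥ λ m< → ge (subst₂ (Below k) (sym (/1≡fromNat m)) (sym (/1≡fromNat a))
  (<-tower⇒Below k 1≤a (nat-<⁺ (≤-trans m< (≤-reflexive (sym (*-identityʳ _)))))))

tower≤⇒LogIterGe : ∀ k m {a} → tower k a ≤ m → LogIterGe k m (+ a / 1)
tower≤⇒LogIterGe k m {a} le below = <⇒≱
  (≤-trans (nat-<⁻ (Below⇒<-tower k a (subst₂ (Below k) (/1≡fromNat m) (/1≡fromNat a) below))) (≤-reflexive (*-identityʳ _)))
  le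

-- Here a is the integer part of the k-fold logarithm of m, found by searching downwards from m.
tower-bracket : ∀ k m → tower k 1 ≤ m → ∃[ a ] (1 ≤ a × tower k a ≤ m × m ≤ tower k (suc a))
tower-bracket k m lower = search m (≤-trans (n≤1+n m) (b≤tower k (suc m)))
  where
  search : ∀ b → m ≤ tower k (suc b) → ∃[ a ] (1 ≤ a × tower k a ≤ m × m ≤ tower k (suc a))
  search zero    m≤ = 1 , ≤-refl , lower , ≤-trans m≤ (tower-mono k (s≤s z≤n))
  search (suc b) m≤ with tower k (suc b) ≤? m
  ... | yes le = suc b , s≤s z≤n , le , m≤
  ... | no  gt = search b (≰⇒≥ gt)

-- Since `bigC R` ≥ 4 = `tower 2 1`, two further logarithms still leave a value of at least 1.
bigC≤⇒tower≤ : ∀ m R δ → LogIterGe (2 * suc δ ∸ 2) m (+ bigC R / 1) → tower (2 * suc δ) 1 ≤ m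
bigC≤⇒tower≤ m R δ hyp = begin
  tower (2 * suc δ) 1      ≡⟨ cong (λ k → tower k 1) (m∸n+n≡m (m≤m*n 2 (suc δ))) ⟨
  tower (k + 2) 1          ≡⟨ tower-+ k 2 1 ⟩
  tower k 4                ≤⟨ tower-mono k (^-monoʳ-≤ 2 {2} {2 ^ (2 + 2 * R)} (^-monoʳ-≤ 2 {1} {2 + 2 * R} (s≤s z≤n))) ⟩
  tower k (bigC R)         ≤⟨ LogIterGe⇒tower≤ k m (m^n>0 2 (2 ^ (2 + 2 * R))) hyp ⟩
  m                        ∎
  where
  open ≤-Reasoning
  k : ℕ
  k = 2 * suc δ ∸ 2

theorem3p2 : (m R δ : ℕ) → 1 ≤ m → 1 ≤ R → 1 ≤ δ →
    LogIterGe (2 * δ ∸ 2) m (+ bigC R / 1) →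
    ∃[ N ] (LogIterGe (2 * δ) m (ratio N R) × ProperColouring m R δ N)
theorem3p2 m R (suc δ) _ _ _ hyp
  with a , 1≤a , tower≤m , m≤tower ← tower-bracket (2 * suc δ) m (bigC≤⇒tower≤ m R δ hyp)
  with N , N≤ , colouring ← tower-colouring δ 1 R a 1≤a
  -- The lower half of the bracket gives a ≤ log^(2δ) m and so the bound on the number of colours;
  -- the upper half embeds [m] into the tower that has been coloured.
  = bigC R * a ,
    subst (LogIterGe (2 * suc δ) m) (sym (c*a/c≡a/1 (bigC R) a {{m^n≢0 2 (2 ^ (2 + 2 * R))}})) (tower≤⇒LogIterGe (2 * suc δ) m tower≤m) ,
    toProperColouring m≤tower (≤-trans N≤ (≤-reflexive (*-identityˡ _))) colouring
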